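{- $VW_0\le_I VWDI$; that is, the first-order theory $VW_0$ is interpretable in the first-order theory $VWDI$ (both defined in the context).
   Context: $T\le_I S$ means that $T$ is (relatively) formally interpretable in $S$ in the usual sense. Both theories include the usual axioms for identity. Strings: $\Sigma^*$ is the set of finite words over $\{1,2\}$, including the empty word $e$; $s^{ -1}$ is the reversal of $s$; $s\sqsubseteq t$ between strings means $s$ is an initial segment of $t$, and $s\sqsupseteq t$ means $s$ is an end segment of $t$ (both possibly improper). $D=\{1,2\}$. The same symbols are used for binary relation symbols. Both vocabularies contain a constant $\underline{s}$ for each $s\in\Sigma^*$. Write $x\sqsubset y$ for $x\sqsubseteq y\ \&\ x\ne y$ and $x\sqsupset y$ for $x\sqsupseteq y\ \&\ x\ne y$. (VW10) is the axiom $\forall x,y(x\sqsubseteq y\ \&\ y\sqsubseteq x\to x=y)$. $VW_0$: vocabulary: the constants $\underline{s}$ and the binary relation symbols $\sqsubseteq,\sqsupseteq$. Axioms: ($VW_0$1) $\neg\,\underline{s}=\underline{t}$ for distinct $s,t\in\Sigma^*$; ($VW_0$2) $\forall x(x\sqsubseteq\underline{t}\leftrightarrow\bigvee_{s\sqsubseteq t}x=\underline{s})$ for $t\in\Sigma^*$; ($VW_0$3) $\forall x(x\sqsupseteq\underline{t}\leftrightarrow\bigvee_{s\sqsupseteq t}x=\underline{s})$ for $t\in\Sigma^*$; ($VW_0$4) $\forall x\big(\forall y(y\sqsubset x\leftrightarrow y\sqsubset\underline{t})\to\bigwedge_{d\in D}(\underline{d}\sqsupseteq x\ \&\ \underline{d}\sqsupseteq\underline{t}\to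 x=\underline{t})\big)$ for $t\in\Sigma^*$; ($VW_0$5) $\forall x\big(\forall y(y\sqsupset x\leftrightarrow y\sqsupset\underline{t})\to\bigwedge_{d\in D}(\underline{d}\sqsubseteq x\ \&\ \underline{d}\sqsubseteq\underline{t}\to x=\underline{t})\big)$ for $t\in\Sigma^*$; and (VW10). $VWDI$: vocabulary: the constants $\underline{s}$, a unary function symbol $f$ and the binary relation symbol $\sqsubseteq$. Axioms: (VWDI1) $\neg\,\underline{s}=\underline{t}$ for distinct $s,t\in\Sigma^*$; (VWDI2) $f(\underline{s})=\underline{s^{ -1}}$ for $s\in\Sigma^*$; (VWDI3) $\forall x(x\sqsubseteq\underline{t}\leftrightarrow\bigvee_{s\sqsubseteq t}x=\underline{s})$ for $t\in\Sigma^*$; (VWDI4) $\forall x\,f(f(x))=x$; (VWDI5) $\forall x\big(\forall y(y\sqsubset x\leftrightarrow y\sqsubset\underline{t})\to\bigwedge_{d\in D}(\underline{d}\sqsubseteq f(x)\ \&\ \underline{d}\sqsubseteq f(\underline{t})\to x=\underline{t})\big)$ for $t\in\Sigma^*$; and (VW10). -}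

module Defs where

open import Data.Fin using (Fin; zero; suc; _↑ˡ_; _↑ʳ_)
open import Data.List using (List; []; _∷_; map; foldr; reverse; inits; tails)
open import Data.List.Membership.Propositional using (_∈_)
open import Data.Nat using (ℕ; zero; suc; _+_)
open import Data.Vec using (Vec; []; _∷_)
open import Data.Vec.Functional using () renaming (_∷_ to _∷ᶠ_)
open import Function using (_∘_)
open import Relation.Binary.PropositionalEquality using (_≢_)

infix  8 _≐_
infixr 7 _∧_
infixr 6 _∨_
infixr 5 _⇒_
infixr 3 ∀′_ ∃′_
infix  1 _≤I_

-- First-order logic with identity, well-scoped de Bruijn style:
-- in Term L n and Formula L n the free variables are those of Fin n,
-- and a quantifier binds variable zero of its body.

record Signature : Set₁ where
  field
    Func : ℕ → Set
    Rel  : ℕ → Set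

open Signature

data Term (L : Signature) (n : ℕ) : Set where
  var : Fin n → Term L n
  fn  : ∀ {k} → Func L k → Vec (Term L n) k → Term L n

data Formula (L : Signature) (n : ℕ) : Set where
  ⊥′      : Formula L n
  _≐_     : Term L n → Term L n → Formula L n
  rel     : ∀ {k} → Rel L k → Vec (Term L n) k → Formula L n
  _⇒_     : Formula L n → Formula L n → Formula L n
  _∧_     : Formula L n → Formula L n → Formula L n
  _∨_     : Formula L n → Formula L n → Formula L n
  ∀′_ ∃′_ : Formula L (suc n) → Formula L n

Sentence : Signature → Set
Sentence L = Formula L 0

Theory : Signature → Set₁
Theory L = Sentence L → Set

module _ {L : Signature} where

  infix  9 _[_]
  infix  8 ¬′_
  infix  4 _⇔_
  infixr 3 ∃!′_
  infix  2 _∣_⊢_ _⊢_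

  ¬′_ : ∀ {n} → Formula L n → Formula L n
  ¬′ φ = φ ⇒ ⊥′

  _⇔_ : ∀ {n} → Formula L n → Formula L n → Formula L n
  φ ⇔ ψ = (φ ⇒ ψ) ∧ (ψ ⇒ φ)

  ⋁ ⋀ : ∀ {n} → List (Formula L n) → Formula L n
  ⋁ = foldr _∨_ ⊥′
  ⋀ = foldr _∧_ (¬′ ⊥′)

  lift : ∀ {m n} → (Fin m → Fin n) → Fin (suc m) → Fin (suc n)
  lift ρ zero    = zero
  lift ρ (suc i) = suc (ρ i)

  renᵗ  : ∀ {m n} → (Fin m → Fin n) → Term L m → Term L n
  renᵗ* : ∀ {m n k} → (Fin m → Fin n) → Vec (Term L m) k → Vec (Term L n) k
  renᵗ ρ (var i)   = var (ρ i)
  renᵗ ρ (fn f ts) = fn f (renᵗ* ρ ts)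
  renᵗ* ρ []       = []
  renᵗ* ρ (t ∷ ts) = renᵗ ρ t ∷ renᵗ* ρ ts

  ren : ∀ {m n} → (Fin m → Fin n) → Formula L m → Formula L n
  ren ρ ⊥′         = ⊥′
  ren ρ (s ≐ t)    = renᵗ ρ s ≐ renᵗ ρ t
  ren ρ (rel R ts) = rel R (renᵗ* ρ ts)
  ren ρ (φ ⇒ ψ)    = ren ρ φ ⇒ ren ρ ψ
  ren ρ (φ ∧ ψ)    = ren ρ φ ∧ ren ρ ψ
  ren ρ (φ ∨ ψ)    = ren ρ φ ∨ ren ρ ψ
  ren ρ (∀′ φ)     = ∀′ ren (lift ρ) φ
  ren ρ (∃′ φ)     = ∃′ ren (lift ρ) φ

  wk : ∀ {n} → Formula L n → Formula L (suc n)
  wk = ren suc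

  liftˢ : ∀ {m n} → (Fin m → Term L n) → Fin (suc m) → Term L (suc n)
  liftˢ σ zero    = var zero
  liftˢ σ (suc i) = renᵗ suc (σ i)

  subᵗ  : ∀ {m n} → (Fin m → Term L n) → Term L m → Term L n
  subᵗ* : ∀ {m n k} → (Fin m → Term L n) → Vec (Term L m) k → Vec (Term L n) k
  subᵗ σ (var i)   = σ i
  subᵗ σ (fn f ts) = fn f (subᵗ* σ ts)
  subᵗ* σ []       = []
  subᵗ* σ (t ∷ ts) = subᵗ σ t ∷ subᵗ* σ ts

  sub : ∀ {m n} → (Fin m → Term L n) → Formula L m → Formula L n
  sub σ ⊥′         = ⊥′
  sub σ (s ≐ t)    = subᵗ σ s ≐ subᵗ σ t
  sub σ (rel R ts) = rel R (subᵗ* σ ts)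
  sub σ (φ ⇒ ψ)    = sub σ φ ⇒ sub σ ψ
  sub σ (φ ∧ ψ)    = sub σ φ ∧ sub σ ψ
  sub σ (φ ∨ ψ)    = sub σ φ ∨ sub σ ψ
  sub σ (∀′ φ)     = ∀′ sub (liftˢ σ) φ
  sub σ (∃′ φ)     = ∃′ sub (liftˢ σ) φ

  _[_] : ∀ {n} → Formula L (suc n) → Term L n → Formula L n
  φ [ t ] = sub (t ∷ᶠ var) φ

  ∃* ∀* : ∀ k {n} → Formula L (k + n) → Formula L n
  ∃* zero    φ = φ
  ∃* (suc k) φ = ∃* k (∃′ φ)
  ∀* zero    φ = φ
  ∀* (suc k) φ = ∀* k (∀′ φ)

  -- Exactly one value of variable zero satisfies φ.
  ∃!′_ : ∀ {n} → Formula L (suc n) → Formula L n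
  ∃!′ φ = ∃′ φ ∧ (∀′ ren (lift suc) φ ⇒ var zero ≐ var (suc zero))

  -- Classical natural deduction with identity from the axioms of T.
  -- The identity axioms of a theory are the rules ≐-refl and ≐-subst.
  -- Since terms are scoped, non-emptiness of the universe, which unscoped
  -- calculi obtain from free variables, has its own rule ∃-universe.
  data _∣_⊢_ (T : Theory L) {n : ℕ} (Γ : List (Formula L n)) : Formula L n → Set where
    axiom      : ∀ {φ} → T φ → T ∣ Γ ⊢ ren (λ ()) φ
    hyp        : ∀ {φ} → φ ∈ Γ → T ∣ Γ ⊢ φ
    ⇒-intro    : ∀ {φ ψ} → T ∣ φ ∷ Γ ⊢ ψ → T ∣ Γ ⊢ φ ⇒ ψ
    ⇒-elim     : ∀ {φ ψ} → T ∣ Γ ⊢ φ ⇒ ψ → T ∣ Γ ⊢ φ → T ∣ Γ ⊢ ψ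
    ∧-intro    : ∀ {φ ψ} → T ∣ Γ ⊢ φ → T ∣ Γ ⊢ ψ → T ∣ Γ ⊢ φ ∧ ψ
    ∧-elimˡ    : ∀ {φ ψ} → T ∣ Γ ⊢ φ ∧ ψ → T ∣ Γ ⊢ φ
    ∧-elimʳ    : ∀ {φ ψ} → T ∣ Γ ⊢ φ ∧ ψ → T ∣ Γ ⊢ ψ
    ∨-introˡ   : ∀ {φ ψ} → T ∣ Γ ⊢ φ → T ∣ Γ ⊢ φ ∨ ψ
    ∨-introʳ   : ∀ {φ ψ} → T ∣ Γ ⊢ ψ → T ∣ Γ ⊢ φ ∨ ψ
    ∨-elim     : ∀ {φ ψ χ} → T ∣ Γ ⊢ φ ∨ ψ → T ∣ φ ∷ Γ ⊢ χ → T ∣ ψ ∷ Γ ⊢ χ → T ∣ Γ ⊢ χ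
    raa        : ∀ {φ} → T ∣ ¬′ φ ∷ Γ ⊢ ⊥′ → T ∣ Γ ⊢ φ
    ∀-intro    : ∀ {φ} → T ∣ map wk Γ ⊢ φ → T ∣ Γ ⊢ ∀′ φ
    ∀-elim     : ∀ {φ} → T ∣ Γ ⊢ ∀′ φ → (t : Term L n) → T ∣ Γ ⊢ φ [ t ]
    ∃-intro    : ∀ {φ} (t : Term L n) → T ∣ Γ ⊢ φ [ t ] → T ∣ Γ ⊢ ∃′ φ
    ∃-elim     : ∀ {φ ψ} → T ∣ Γ ⊢ ∃′ φ → T ∣ φ ∷ map wk Γ ⊢ wk ψ → T ∣ Γ ⊢ ψ
    ∃-universe : T ∣ Γ ⊢ ∃′ var zero ≐ var zero
    ≐-refl     : ∀ t → T ∣ Γ ⊢ t ≐ t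
    ≐-subst    : ∀ φ {s t} → T ∣ Γ ⊢ s ≐ t → T ∣ Γ ⊢ φ [ s ] → T ∣ Γ ⊢ φ [ t ]

  _⊢_ : Theory L → Sentence L → Set
  T ⊢ φ = T ∣ [] ⊢ φ

-- A translation of L into L′: a domain formula and, for each non-logical
-- symbol, a formula of L′.  A k-ary function symbol is given by its graph,
-- where variable zero is the value and variables 1, …, k are the arguments.
-- Identity is translated as identity.

record Translation (L L′ : Signature) : Set where
  field
    domain   : Formula L′ 1
    relation : ∀ {k} → Rel L k → Formula L′ k
    graph    : ∀ {k} → Func L k → Formula L′ (suc k)

  inDomain : ∀ {n} → Fin n → Formula L′ n
  inDomain i = ren (λ _ → i) domain

  allInDomain : ∀ {n} k → (Fin k → Fin n) → Formula L′ n
  allInDomain zero    z = ¬′ ⊥′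
  allInDomain (suc k) z = inDomain (z zero) ∧ allInDomain k (z ∘ suc)

  -- value t ρ y says that y is the value of t when each variable i of t is
  -- read as ρ i.  Function symbols are eliminated by quantifying (within the
  -- domain) over the values of their arguments.
  value  : ∀ {m n} → Term L m → (Fin m → Fin n) → Fin n → Formula L′ n
  values : ∀ {m n k} → Vec (Term L m) k → (Fin m → Fin n) → (Fin k → Fin n) → Formula L′ n
  value     (var i)           ρ y = var y ≐ var (ρ i)
  value {n = n} (fn {k} f ts) ρ y =
    ∃* k (allInDomain k (_↑ˡ n)
          ∧ values ts ((k ↑ʳ_) ∘ ρ) (_↑ˡ n)
          ∧ ren ((k ↑ʳ y) ∷ᶠ (_↑ˡ n)) (graph f))
  values []       ρ z = ¬′ ⊥′
  values (t ∷ ts) ρ z = value t ρ (z zero) ∧ values ts ρ (z ∘ suc)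

  translate : ∀ {n} → Formula L n → Formula L′ n
  translate ⊥′      = ⊥′
  translate (s ≐ t) = ∃′ inDomain zero ∧ value s suc zero ∧ value t suc zero
  translate {n} (rel {k} R ts) =
    ∃* k (allInDomain k (_↑ˡ n)
          ∧ values ts (k ↑ʳ_) (_↑ˡ n)
          ∧ ren (_↑ˡ n) (relation R))
  translate (φ ⇒ ψ) = translate φ ⇒ translate ψ
  translate (φ ∧ ψ) = translate φ ∧ translate ψ
  translate (φ ∨ ψ) = translate φ ∨ translate ψ
  translate (∀′ φ)  = ∀′ inDomain zero ⇒ translate φ
  translate (∃′ φ)  = ∃′ inDomain zero ∧ translate φ

  functional : ∀ {k} → Func L k → Sentence L′
  functional {k} f =
    ∀* k (allInDomain k (_↑ˡ 0)
          ⇒ (∃!′ (inDomain zero ∧ ren (zero ∷ᶠ (suc ∘ (_↑ˡ 0))) (graph f))))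

-- T ≤I S: T is relatively interpretable in S.
record _≤I_ {L L′ : Signature} (T : Theory L) (S : Theory L′) : Set where
  field
    translation : Translation L L′
  open Translation translation
  field
    domain-nonempty : S ⊢ ∃′ domain
    functions       : ∀ {k} (f : Func L k) → S ⊢ functional f
    axioms          : ∀ {φ} → T φ → S ⊢ translate φ

data Letter : Set where
  𝟏 𝟐 : Letter

Word : Set
Word = List Letter

D : List Letter
D = 𝟏 ∷ 𝟐 ∷ []

data Func₀ : ℕ → Set where
  const : Word → Func₀ 0

data Rel₀ : ℕ → Set where
  initial end : Rel₀ 2

L₀ : Signature
L₀ = record { Func = Func₀ ; Rel = Rel₀ }

module _ {n : ℕ} where

  ⌜_⌝₀ : Word → Term L₀ n
  ⌜ s ⌝₀ = fn (const s) []

  infix 8 _⊑₀_ _⊒₀_ _⊏₀_ _⊐₀_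

  _⊑₀_ _⊒₀_ _⊏₀_ _⊐₀_ : Term L₀ n → Term L₀ n → Formula L₀ n
  x ⊑₀ y = rel initial (x ∷ y ∷ [])
  x ⊒₀ y = rel end (x ∷ y ∷ [])
  x ⊏₀ y = x ⊑₀ y ∧ ¬′ (x ≐ y)
  x ⊐₀ y = x ⊒₀ y ∧ ¬′ (x ≐ y)

-- The initial (end) segments of t are the entries of inits t (tails t).
data VW₀ : Theory L₀ where
  VW₀1 : ∀ s t → s ≢ t → VW₀ (¬′ (⌜ s ⌝₀ ≐ ⌜ t ⌝₀))
  VW₀2 : ∀ t → let x = var zero in
    VW₀ (∀′ x ⊑₀ ⌜ t ⌝₀ ⇔ ⋁ (map (λ s → x ≐ ⌜ s ⌝₀) (inits t)))
  VW₀3 : ∀ t → let x = var zero in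
    VW₀ (∀′ x ⊒₀ ⌜ t ⌝₀ ⇔ ⋁ (map (λ s → x ≐ ⌜ s ⌝₀) (tails t)))
  VW₀4 : ∀ t → let x = var zero; x↑ = var (suc zero); y = var zero in
    VW₀ (∀′ (∀′ y ⊏₀ x↑ ⇔ y ⊏₀ ⌜ t ⌝₀)
            ⇒ ⋀ (map (λ d → ⌜ d ∷ [] ⌝₀ ⊒₀ x ∧ ⌜ d ∷ [] ⌝₀ ⊒₀ ⌜ t ⌝₀ ⇒ x ≐ ⌜ t ⌝₀) D))
  VW₀5 : ∀ t → let x = var zero; x↑ = var (suc zero); y = var zero in
    VW₀ (∀′ (∀′ y ⊐₀ x↑ ⇔ y ⊐₀ ⌜ t ⌝₀)
            ⇒ ⋀ (map (λ d → ⌜ d ∷ [] ⌝₀ ⊑₀ x ∧ ⌜ d ∷ [] ⌝₀ ⊑₀ ⌜ t ⌝₀ ⇒ x ≐ ⌜ t ⌝₀) D))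
  VW10 : let x = var (suc zero); y = var zero in
    VW₀ (∀′ ∀′ x ⊑₀ y ∧ y ⊑₀ x ⇒ x ≐ y)

data Funcᵢ : ℕ → Set where
  const : Word → Funcᵢ 0
  f     : Funcᵢ 1

data Relᵢ : ℕ → Set where
  initial : Relᵢ 2

Lᵢ : Signature
Lᵢ = record { Func = Funcᵢ ; Rel = Relᵢ }

module _ {n : ℕ} where

  ⌜_⌝ᵢ : Word → Term Lᵢ n
  ⌜ s ⌝ᵢ = fn (const s) []

  fᵢ : Term Lᵢ n → Term Lᵢ n
  fᵢ x = fn f (x ∷ [])

  infix 8 _⊑ᵢ_ _⊏ᵢ_

  _⊑ᵢ_ _⊏ᵢ_ : Term Lᵢ n → Term Lᵢ n → Formula Lᵢ n
  x ⊑ᵢ y = rel initial (x ∷ y ∷ [])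
  x ⊏ᵢ y = x ⊑ᵢ y ∧ ¬′ (x ≐ y)

data VWDI : Theory Lᵢ where
  VWDI1 : ∀ s t → s ≢ t → VWDI (¬′ (⌜ s ⌝ᵢ ≐ ⌜ t ⌝ᵢ))
  VWDI2 : ∀ s → VWDI (fᵢ ⌜ s ⌝ᵢ ≐ ⌜ reverse s ⌝ᵢ)
  VWDI3 : ∀ t → let x = var zero in
    VWDI (∀′ x ⊑ᵢ ⌜ t ⌝ᵢ ⇔ ⋁ (map (λ s → x ≐ ⌜ s ⌝ᵢ) (inits t)))
  VWDI4 : let x = var zero in
    VWDI (∀′ fᵢ (fᵢ x) ≐ x)
  VWDI5 : ∀ t → let x = var zero; x↑ = var (suc zero); y = var zero in
    VWDI (∀′ (∀′ y ⊏ᵢ x↑ ⇔ y ⊏ᵢ ⌜ t ⌝ᵢ)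
             ⇒ ⋀ (map (λ d → ⌜ d ∷ [] ⌝ᵢ ⊑ᵢ fᵢ x ∧ ⌜ d ∷ [] ⌝ᵢ ⊑ᵢ fᵢ ⌜ t ⌝ᵢ ⇒ x ≐ ⌜ t ⌝ᵢ) D))
  VW10  : let x = var (suc zero); y = var zero in
    VWDI (∀′ ∀′ x ⊑ᵢ y ∧ y ⊑ᵢ x ⇒ x ≐ y)

{-# OPTIONS --safe #-}
module Submission where

open import Defs
open import Data.Fin using (Fin; zero; suc; _↑ˡ_; _↑ʳ_)
open import Data.List using (List; []; _∷_; _++_; map; reverse; inits; tails)
open import Data.List.Membership.Propositional using (_∈_)
open import Data.List.Membership.Propositional.Properties using (∈-map⁺; map∷⁻)
open import Data.List.Properties using (reverse-++; reverse-involutive)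
open import Data.List.Relation.Unary.Any using (here; there)
open import Data.Nat using (ℕ; suc)
open import Data.Product using (∃; _,_)
open import Data.Vec using (Vec; []; _∷_)
open import Data.Vec.Functional using () renaming (_∷_ to _∷ᶠ_)
open import Relation.Binary.PropositionalEquality
  using (_≡_; refl; sym; trans; cong; cong₂; subst; subst₂)

-- The interpretation keeps the universe, the constants and ⊑, and reads x ⊒ y as
-- f x ⊑ f y.  Since f is an involution that reverses the constants, applying it to
-- the bound variables turns VW₀3 and VW₀5 for t into VWDI3 and VWDI5 for reverse t.

private variable
  L   : Signature
  m n : ℕ
  A   : Set

-- Renamings undone by substitutions

sub-renᵗ-id : {ρ : Fin m → Fin n} {σ : Fin n → Term L m} → (∀ i → σ (ρ i) ≡ var i) →
              ∀ t → subᵗ σ (renᵗ ρ t) ≡ t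
sub-renᵗ*-id : {ρ : Fin m → Fin n} {σ : Fin n → Term L m} → (∀ i → σ (ρ i) ≡ var i) →
               ∀ {k} (ts : Vec (Term L m) k) → subᵗ* σ (renᵗ* ρ ts) ≡ ts
sub-renᵗ-id eq (var i)   = eq i
sub-renᵗ-id eq (fn g ts) = cong (fn g) (sub-renᵗ*-id eq ts)
sub-renᵗ*-id eq []       = refl
sub-renᵗ*-id eq (t ∷ ts) = cong₂ _∷_ (sub-renᵗ-id eq t) (sub-renᵗ*-id eq ts)

lift-id : {ρ : Fin m → Fin n} {σ : Fin n → Term L m} → (∀ i → σ (ρ i) ≡ var i) →
          ∀ i → liftˢ σ (lift {L} ρ i) ≡ var i
lift-id eq zero    = refl
lift-id eq (suc i) = cong (renᵗ suc) (eq i)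

-- The quantifier and identity rules produce a substitution after a renaming, which does not reduce
-- for an arbitrary formula. The pointwise hypothesis passes under binders by `lift-id`, so function
-- extensionality is avoided.
sub-ren-id : {ρ : Fin m → Fin n} {σ : Fin n → Term L m} → (∀ i → σ (ρ i) ≡ var i) →
             ∀ φ → sub σ (ren ρ φ) ≡ φ
sub-ren-id eq ⊥′         = refl
sub-ren-id eq (s ≐ t)    = cong₂ _≐_ (sub-renᵗ-id eq s) (sub-renᵗ-id eq t)
sub-ren-id eq (rel R ts) = cong (rel R) (sub-renᵗ*-id eq ts)
sub-ren-id eq (φ ⇒ ψ)    = cong₂ _⇒_ (sub-ren-id eq φ) (sub-ren-id eq ψ)
sub-ren-id eq (φ ∧ ψ)    = cong₂ _∧_ (sub-ren-id eq φ) (sub-ren-id eq ψ)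
sub-ren-id eq (φ ∨ ψ)    = cong₂ _∨_ (sub-ren-id eq φ) (sub-ren-id eq ψ)
sub-ren-id eq (∀′ φ)     = cong ∀′_ (sub-ren-id (lift-id eq) φ)
sub-ren-id eq (∃′ φ)     = cong ∃′_ (sub-ren-id (lift-id eq) φ)

sub-wkᵗ : (u t : Term L n) → subᵗ (u ∷ᶠ var) (renᵗ suc t) ≡ t
sub-wkᵗ u = sub-renᵗ-id (λ _ → refl)

sub-wk : (u : Term L n) (φ : Formula L n) → (wk φ) [ u ] ≡ φ
sub-wk u = sub-ren-id (λ _ → refl)

-- A hypothesis `∀′ φ` moved under a new binder becomes `∀′ ren (lift suc) φ`; its instance at the
-- fresh variable has to be `φ` again.
sub-lift-suc : (φ : Formula L (suc n)) → (ren (lift {L} suc) φ) [ var zero ] ≡ φ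
sub-lift-suc = sub-ren-id λ { zero → refl ; (suc i) → refl }

-- Derived rules of natural deduction

module _ {T : Theory L} {Γ : List (Formula L n)} where

  hyp₀ : ∀ {φ} → T ∣ φ ∷ Γ ⊢ φ
  hyp₀ = hyp (here refl)

  hyp₁ : ∀ {φ ψ} → T ∣ ψ ∷ φ ∷ Γ ⊢ φ
  hyp₁ = hyp (there (here refl))

  ⊤-intro : T ∣ Γ ⊢ ¬′ ⊥′
  ⊤-intro = ⇒-intro hyp₀

  ⇔-to : ∀ {φ ψ} → T ∣ Γ ⊢ φ ⇔ ψ → T ∣ Γ ⊢ φ → T ∣ Γ ⊢ ψ
  ⇔-to e = ⇒-elim (∧-elimˡ e)

  ⇔-from : ∀ {φ ψ} → T ∣ Γ ⊢ φ ⇔ ψ → T ∣ Γ ⊢ ψ → T ∣ Γ ⊢ φ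
  ⇔-from e = ⇒-elim (∧-elimʳ e)

  ⇔-sym : ∀ {φ ψ} → T ∣ Γ ⊢ φ ⇔ ψ → T ∣ Γ ⊢ ψ ⇔ φ
  ⇔-sym e = ∧-intro (∧-elimʳ e) (∧-elimˡ e)

  ⇔-refl : ∀ {φ} → T ∣ Γ ⊢ φ ⇔ φ
  ⇔-refl = ∧-intro (⇒-intro hyp₀) (⇒-intro hyp₀)

  ⋁-intro : ∀ (φ : A → Formula L n) {a as} → a ∈ as → T ∣ Γ ⊢ φ a → T ∣ Γ ⊢ ⋁ (map φ as)
  ⋁-intro φ (here refl) d = ∨-introˡ d
  ⋁-intro φ (there a∈)  d = ∨-introʳ (⋁-intro φ a∈ d)

  ⋀-map : (φ ψ : A → Formula L n) → (∀ a → T ∣ Γ ⊢ φ a → T ∣ Γ ⊢ ψ a) →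
          ∀ as → T ∣ Γ ⊢ ⋀ (map φ as) → T ∣ Γ ⊢ ⋀ (map ψ as)
  ⋀-map φ ψ h []       d = d
  ⋀-map φ ψ h (a ∷ as) d = ∧-intro (h a (∧-elimˡ d)) (⋀-map φ ψ h as (∧-elimʳ d))

  ≐-sym : ∀ {s t} → T ∣ Γ ⊢ s ≐ t → T ∣ Γ ⊢ t ≐ s
  -- Variable zero marks the place to be replaced; the rewrites cancel the weakening of the term
  -- that stays fixed.
  ≐-sym {s} {t} p with r ← ≐-subst (var zero ≐ renᵗ suc s) p
    rewrite sub-wkᵗ s s | sub-wkᵗ t s = r (≐-refl s)

  ≐-trans : ∀ {s t u} → T ∣ Γ ⊢ s ≐ t → T ∣ Γ ⊢ t ≐ u → T ∣ Γ ⊢ s ≐ u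
  ≐-trans {s} {t} {u} p q with r ← ≐-subst (renᵗ suc s ≐ var zero) q
    rewrite sub-wkᵗ t s | sub-wkᵗ u s = r p

-- Weakening is only admissible, not a rule of the calculus, so a premise that is used in several
-- contexts is assumed derivable in all of them.

infix 2 _⊩_

_⊩_ : Theory L → Formula L n → Set
T ⊩ φ = ∀ {Γ} → T ∣ Γ ⊢ φ

module _ {T : Theory L} where

  -- The first equivalence may depend on the context, since it is cut in as a hypothesis. The second
  -- is used below further hypotheses and so is needed in every context.
  ⇔-trans : ∀ {n} {φ ψ χ : Formula L n} {Γ} →
            T ∣ Γ ⊢ φ ⇔ ψ → T ⊩ ψ ⇔ χ → T ∣ Γ ⊢ φ ⇔ χ
  ⇔-trans {φ = φ} {ψ} {χ} d e = ⇒-elim (⇒-intro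
    (∧-intro (⇒-intro (⇔-to e (⇔-to hyp₁ hyp₀)))
             (⇒-intro (⇔-from hyp₁ (⇔-from e hyp₀))))) d

  ∧-cong : ∀ {n} {φ φ′ ψ ψ′ : Formula L n} →
           T ⊩ φ ⇔ φ′ → T ⊩ ψ ⇔ ψ′ → T ⊩ φ ∧ ψ ⇔ φ′ ∧ ψ′
  ∧-cong d e = ∧-intro
    (⇒-intro (∧-intro (⇔-to d (∧-elimˡ hyp₀)) (⇔-to e (∧-elimʳ hyp₀))))
    (⇒-intro (∧-intro (⇔-from d (∧-elimˡ hyp₀)) (⇔-from e (∧-elimʳ hyp₀))))

  ∨-cong : ∀ {n} {φ φ′ ψ ψ′ : Formula L n} →
           T ⊩ φ ⇔ φ′ → T ⊩ ψ ⇔ ψ′ → T ⊩ φ ∨ ψ ⇔ φ′ ∨ ψ′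
  ∨-cong d e = ∧-intro
    (⇒-intro (∨-elim hyp₀ (∨-introˡ (⇔-to d hyp₀)) (∨-introʳ (⇔-to e hyp₀))))
    (⇒-intro (∨-elim hyp₀ (∨-introˡ (⇔-from d hyp₀)) (∨-introʳ (⇔-from e hyp₀))))

  ⇒-cong : ∀ {n} {φ φ′ ψ ψ′ : Formula L n} →
           T ⊩ φ ⇔ φ′ → T ⊩ ψ ⇔ ψ′ → T ⊩ (φ ⇒ ψ) ⇔ (φ′ ⇒ ψ′)
  ⇒-cong d e = ∧-intro
    (⇒-intro (⇒-intro (⇔-to e (⇒-elim hyp₁ (⇔-from d hyp₀)))))
    (⇒-intro (⇒-intro (⇔-from e (⇒-elim hyp₁ (⇔-to d hyp₀)))))

  ∀-mono : ∀ {n} {φ ψ : Formula L (suc n)} → T ⊩ φ ⇒ ψ → T ⊩ (∀′ φ) ⇒ (∀′ ψ)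
  ∀-mono {φ = φ} d {Γ} = ⇒-intro (∀-intro (⇒-elim d
    (subst (T ∣ wk (∀′ φ) ∷ map wk Γ ⊢_) (sub-lift-suc φ) (∀-elim hyp₀ (var zero)))))

  ∃-mono : ∀ {n} {φ ψ : Formula L (suc n)} → T ⊩ φ ⇒ ψ → T ⊩ (∃′ φ) ⇒ (∃′ ψ)
  ∃-mono {ψ = ψ} d = ⇒-intro (∃-elim hyp₀ (∃-intro (var zero)
    (subst (T ∣ _ ⊢_) (sym (sub-lift-suc ψ)) (⇒-elim d hyp₀))))

  ∀-cong : ∀ {n} {φ ψ : Formula L (suc n)} → T ⊩ φ ⇔ ψ → T ⊩ (∀′ φ) ⇔ (∀′ ψ)
  ∀-cong d = ∧-intro (∀-mono (∧-elimˡ d)) (∀-mono (∧-elimʳ d))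

  ∃-cong : ∀ {n} {φ ψ : Formula L (suc n)} → T ⊩ φ ⇔ ψ → T ⊩ (∃′ φ) ⇔ (∃′ ψ)
  ∃-cong d = ∧-intro (∃-mono (∧-elimˡ d)) (∃-mono (∧-elimʳ d))

  ⋁-elim : ∀ {n} (φ : A → Formula L n) {χ} as →
           (∀ {a} → a ∈ as → T ⊩ φ a ⇒ χ) → T ⊩ ⋁ (map φ as) ⇒ χ
  -- The empty disjunction is `⊥′`, and `raa` serves as ex falso.
  ⋁-elim φ []       h = ⇒-intro (raa hyp₁)
  ⋁-elim φ (a ∷ as) h = ⇒-intro (∨-elim hyp₀
    (⇒-elim (h (here refl)) hyp₀)
    (⇒-elim (⋁-elim φ as (λ a∈ → h (there a∈))) hyp₀))

  ⊤⇒-unit : ∀ {n} {φ : Formula L n} → T ⊩ (¬′ ⊥′ ⇒ φ) ⇔ φ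
  ⊤⇒-unit = ∧-intro (⇒-intro (⇒-elim hyp₀ ⊤-intro)) (⇒-intro (⇒-intro hyp₁))

  ⊤∧-unit : ∀ {n} {φ : Formula L n} → T ⊩ ¬′ ⊥′ ∧ φ ⇔ φ
  ⊤∧-unit = ∧-intro (⇒-intro (∧-elimʳ hyp₀)) (⇒-intro (∧-intro ⊤-intro hyp₀))

  -- Translated atoms quantify over the values of their terms; this removes such a quantifier when
  -- the value is pinned to `u`. Generalising the second premise and instantiating it at `u` turns
  -- its equation into `u ≐ u`.
  one-point : ∀ {n} (u : Term L n) {φ : Formula L (suc n)} {ψ : Formula L n} →
              T ⊩ φ ⇒ wk ψ → T ⊩ var zero ≐ renᵗ suc u ⇒ wk ψ ⇒ φ → T ⊩ (∃′ φ) ⇔ ψ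
  one-point u {φ} {ψ} d e {Γ} = ∧-intro
    (⇒-intro (∃-elim hyp₀ (⇒-elim d hyp₀)))
    (⇒-intro (∃-intro u (⇒-elim (⇒-elim at-u (≐-refl u)) hyp₀)))
    where
    at-u : T ∣ ψ ∷ Γ ⊢ u ≐ u ⇒ ψ ⇒ φ [ u ]
    at-u = subst₂ (λ v χ → T ∣ ψ ∷ Γ ⊢ u ≐ v ⇒ χ ⇒ φ [ u ]) (sub-wkᵗ u u) (sub-wk u ψ)
                  (∀-elim (∀-intro e) u)

  -- Two uses of `one-point`, the inner variable first. The equation for the outer variable is
  -- carried along beside `ψ` for the second use.
  two-point : ∀ {n} (u v : Term L n) {φ : Formula L (suc (suc n))} {ψ : Formula L n} →
              let u↑ = renᵗ suc (renᵗ suc u); v↑ = renᵗ suc (renᵗ suc v) in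
              T ⊩ φ ⇒ var (suc zero) ≐ v↑ ∧ wk (wk ψ) →
              T ⊩ var zero ≐ u↑ ⇒ var (suc zero) ≐ v↑ ∧ wk (wk ψ) ⇒ φ →
              T ⊩ (∃′ ∃′ φ) ⇔ ψ
  two-point u v {φ} {ψ} d e = one-point v
    (⇒-intro (∧-elimʳ (⇔-to inner hyp₀)))
    (⇒-intro (⇒-intro (⇔-from inner (∧-intro hyp₁ hyp₀))))
    where
    inner : T ⊩ (∃′ φ) ⇔ var zero ≐ renᵗ suc v ∧ wk ψ
    inner = one-point (renᵗ suc u) d e

module _ {T : Theory Lᵢ} {Γ : List (Formula Lᵢ n)} where

  fᵢ-cong : ∀ {s t} → T ∣ Γ ⊢ s ≐ t → T ∣ Γ ⊢ fᵢ s ≐ fᵢ t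
  fᵢ-cong {s} {t} p with r ← ≐-subst (fᵢ (renᵗ suc s) ≐ fᵢ (var zero)) p
    rewrite sub-wkᵗ s s | sub-wkᵗ t s = r (≐-refl (fᵢ s))

  ⊑-cong : ∀ {s s′ t t′} → T ∣ Γ ⊢ s ≐ s′ → T ∣ Γ ⊢ t ≐ t′ →
           T ∣ Γ ⊢ s ⊑ᵢ t ⇔ s′ ⊑ᵢ t′
  ⊑-cong {s} {s′} {t} {t′} p q
    -- Starting from the reflexive equivalence, the right-hand side is changed one argument at a
    -- time.
    with r₁ ← ≐-subst (renᵗ suc s ⊑ᵢ renᵗ suc t ⇔ var zero ⊑ᵢ renᵗ suc t) p
       | r₂ ← ≐-subst (renᵗ suc s ⊑ᵢ renᵗ suc t ⇔ renᵗ suc s′ ⊑ᵢ var zero) q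
    rewrite sub-wkᵗ s s | sub-wkᵗ s t | sub-wkᵗ s′ s | sub-wkᵗ s′ t
          | sub-wkᵗ t s | sub-wkᵗ t t | sub-wkᵗ t s′ | sub-wkᵗ t′ s | sub-wkᵗ t′ t
          | sub-wkᵗ t′ s′ = r₂ (r₁ ⇔-refl)

-- The translation and its direct reading

end⇒f : Translation L₀ Lᵢ
end⇒f = record
  { domain   = ¬′ ⊥′
  ; relation = λ { initial → var zero ⊑ᵢ var (suc zero)
                 ; end     → fᵢ (var zero) ⊑ᵢ fᵢ (var (suc zero)) }
  ; graph    = λ { (const s) → var zero ≐ ⌜ s ⌝ᵢ }
  }

open Translation end⇒f

directᵗ : Term L₀ n → Term Lᵢ n
directᵗ (var i)           = var i
directᵗ (fn (const s) []) = ⌜ s ⌝ᵢ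

-- The function symbols of `L₀` are all constants, so each term has a counterpart in `Lᵢ` and the
-- value quantifiers of `translate` can be avoided. The axioms are checked in this form.
direct : Formula L₀ n → Formula Lᵢ n
direct ⊥′                         = ⊥′
direct (s ≐ t)                    = directᵗ s ≐ directᵗ t
direct (rel initial (s ∷ t ∷ [])) = directᵗ s ⊑ᵢ directᵗ t
direct (rel end (s ∷ t ∷ []))     = fᵢ (directᵗ s) ⊑ᵢ fᵢ (directᵗ t)
direct (φ ⇒ ψ)                    = direct φ ⇒ direct ψ
direct (φ ∧ ψ)                    = direct φ ∧ direct ψ
direct (φ ∨ ψ)                    = direct φ ∨ direct ψ
direct (∀′ φ)                     = ∀′ direct φ
direct (∃′ φ)                     = ∃′ direct φ

module _ {T : Theory Lᵢ} where

  value-⇔ : ∀ {m n} (t : Term L₀ m) {ρ : Fin m → Fin n} {y} →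
            T ⊩ value t ρ y ⇔ var y ≐ renᵗ ρ (directᵗ t)
  value-⇔ (var i)           = ⇔-refl
  -- With no arguments, the value formula is the graph conjoined with two true formulas.
  value-⇔ (fn (const s) []) = ∧-intro
    (⇒-intro (∧-elimʳ (∧-elimʳ hyp₀)))
    (⇒-intro (∧-intro ⊤-intro (∧-intro ⊤-intro hyp₀)))

  -- The case split lets renaming by `2 ↑ʳ_` and two successive weakenings compute to the same term.
  value₂-⇔ : (t : Term L₀ n) {y : Fin (suc (suc n))} →
             T ⊩ value t (2 ↑ʳ_) y ⇔ var y ≐ renᵗ suc (renᵗ suc (directᵗ t))
  value₂-⇔ t@(var i)           = value-⇔ t {ρ = 2 ↑ʳ_}
  value₂-⇔ t@(fn (const s) []) = value-⇔ t {ρ = 2 ↑ʳ_}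

  ≐-translate-⇔ : (s t : Term L₀ n) → T ⊩ translate (s ≐ t) ⇔ direct (s ≐ t)
  ≐-translate-⇔ s t = one-point (directᵗ s)
    (⇒-intro (≐-trans
      (≐-sym (⇔-to (value-⇔ s) (∧-elimˡ (∧-elimʳ hyp₀))))
      (⇔-to (value-⇔ t) (∧-elimʳ (∧-elimʳ hyp₀)))))
    (⇒-intro (⇒-intro (∧-intro ⊤-intro
      (∧-intro (⇔-from (value-⇔ s) hyp₁) (⇔-from (value-⇔ t) (≐-trans hyp₁ hyp₀))))))

  -- Unfolding the arguments is the same for both symbols; only the congruence `h` of the
  -- interpreting formula differs.
  rel-translate-⇔ : (R : Rel₀ 2) (s t : Term L₀ n) {ψ : Formula Lᵢ n} →
    (∀ {Γ} → T ∣ Γ ⊢ var zero ≐ renᵗ suc (renᵗ suc (directᵗ s)) →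
             T ∣ Γ ⊢ var (suc zero) ≐ renᵗ suc (renᵗ suc (directᵗ t)) →
             T ∣ Γ ⊢ ren (_↑ˡ n) (relation R) ⇔ wk (wk ψ)) →
    T ⊩ translate (rel R (s ∷ t ∷ [])) ⇔ ψ
  rel-translate-⇔ R s t h = two-point (directᵗ s) (directᵗ t)
    (⇒-intro (∧-intro (⇔-to (value₂-⇔ t) t-value)
      (⇔-to (h (⇔-to (value₂-⇔ s) s-value) (⇔-to (value₂-⇔ t) t-value))
            (∧-elimʳ (∧-elimʳ hyp₀)))))
    (⇒-intro (⇒-intro (∧-intro
      (∧-intro ⊤-intro (∧-intro ⊤-intro ⊤-intro))
      (∧-intro
        (∧-intro (⇔-from (value₂-⇔ s) hyp₁)
          (∧-intro (⇔-from (value₂-⇔ t) (∧-elimˡ hyp₀)) ⊤-intro))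
        (⇔-from (h hyp₁ (∧-elimˡ hyp₀)) (∧-elimʳ hyp₀))))))
    where
    s-value : ∀ {m} {φ₁ φ₂ φ₃ φ₄ φ₅ : Formula Lᵢ m} {Γ} → T ∣ φ₁ ∧ (φ₂ ∧ φ₃ ∧ φ₄) ∧ φ₅ ∷ Γ ⊢ φ₂
    s-value = ∧-elimˡ (∧-elimˡ (∧-elimʳ hyp₀))

    t-value : ∀ {m} {φ₁ φ₂ φ₃ φ₄ φ₅ : Formula Lᵢ m} {Γ} → T ∣ φ₁ ∧ (φ₂ ∧ φ₃ ∧ φ₄) ∧ φ₅ ∷ Γ ⊢ φ₃
    t-value = ∧-elimˡ (∧-elimʳ (∧-elimˡ (∧-elimʳ hyp₀)))

  translate-⇔ : (φ : Formula L₀ n) → T ⊩ translate φ ⇔ direct φ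
  translate-⇔ ⊥′                         = ⇔-refl
  translate-⇔ (s ≐ t)                    = ≐-translate-⇔ s t
  translate-⇔ (rel initial (s ∷ t ∷ [])) = rel-translate-⇔ initial s t ⊑-cong
  translate-⇔ (rel end (s ∷ t ∷ []))     =
    rel-translate-⇔ end s t λ p q → ⊑-cong (fᵢ-cong p) (fᵢ-cong q)
  translate-⇔ (φ ⇒ ψ) = ⇒-cong (translate-⇔ φ) (translate-⇔ ψ)
  translate-⇔ (φ ∧ ψ) = ∧-cong (translate-⇔ φ) (translate-⇔ ψ)
  translate-⇔ (φ ∨ ψ) = ∨-cong (translate-⇔ φ) (translate-⇔ ψ)
  -- The domain formula is `¬′ ⊥′`, so the relativising guard drops out.
  translate-⇔ (∀′ φ)  = ∀-cong (⇔-trans ⊤⇒-unit (translate-⇔ φ))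
  translate-⇔ (∃′ φ)  = ∃-cong (⇔-trans ⊤∧-unit (translate-⇔ φ))

-- Segments of words

module _ {A : Set} where

  ∈-inits⁺ : (s r : List A) → s ∈ inits (s ++ r)
  ∈-inits⁺ []      r = here refl
  ∈-inits⁺ (a ∷ s) r = there (∈-map⁺ (a ∷_) (∈-inits⁺ s r))

  ∈-inits⁻ : ∀ {s} (t : List A) → s ∈ inits t → ∃ λ r → t ≡ s ++ r
  ∈-inits⁻ t       (here refl) = t , refl
  ∈-inits⁻ (a ∷ t) (there s∈)  with _ , s′∈ , refl ← map∷⁻ s∈
                               with r , refl ← ∈-inits⁻ t s′∈ = r , refl

  ∈-tails⁺ : (r s : List A) → s ∈ tails (r ++ s)
  ∈-tails⁺ []      s = here refl
  ∈-tails⁺ (_ ∷ r) s = there (∈-tails⁺ r s)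

  ∈-tails⁻ : ∀ {s} (t : List A) → s ∈ tails t → ∃ λ r → t ≡ r ++ s
  ∈-tails⁻ t       (here refl) = [] , refl
  ∈-tails⁻ (a ∷ t) (there s∈)  with r , refl ← ∈-tails⁻ t s∈ = a ∷ r , refl

  -- Reversing `t ≡ r ++ s` puts `reverse s` in front. With the converse below, this matches the
  -- disjuncts of `VW₀3` for `t` with those of `VWDI3` for `reverse t`.
  reverse-∈-inits : ∀ {s} (t : List A) → s ∈ tails t → reverse s ∈ inits (reverse t)
  reverse-∈-inits {s} t s∈ with r , refl ← ∈-tails⁻ t s∈ =
    subst (λ u → reverse s ∈ inits u) (sym (reverse-++ r s)) (∈-inits⁺ (reverse s) (reverse r))

  reverse-∈-tails : ∀ {s} (t : List A) → s ∈ inits (reverse t) → reverse s ∈ tails t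
  reverse-∈-tails {s} t s∈ with r , eq ← ∈-inits⁻ (reverse t) s∈ =
    subst (λ u → reverse s ∈ tails u)
      (trans (sym (reverse-++ s r)) (trans (cong reverse (sym eq)) (reverse-involutive t)))
      (∈-tails⁺ (reverse r) (reverse s))

-- Consequences of VWDI

-- The disjunctions range over lists that depend on a word, so syntactic operations pass through
-- them only by induction.
ren-⋁-≐ : (ρ : Fin m → Fin n) (u : Term Lᵢ m) (ss : List Word) →
          ren ρ (⋁ (map (λ s → u ≐ ⌜ s ⌝ᵢ) ss)) ≡ ⋁ (map (λ s → renᵗ ρ u ≐ ⌜ s ⌝ᵢ) ss)
ren-⋁-≐ ρ u []       = refl
ren-⋁-≐ ρ u (s ∷ ss) = cong (_ ∨_) (ren-⋁-≐ ρ u ss)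

sub-⋁-≐ : (σ : Fin m → Term Lᵢ n) (u : Term Lᵢ m) (ss : List Word) →
          sub σ (⋁ (map (λ s → u ≐ ⌜ s ⌝ᵢ) ss)) ≡ ⋁ (map (λ s → subᵗ σ u ≐ ⌜ s ⌝ᵢ) ss)
sub-⋁-≐ σ u []       = refl
sub-⋁-≐ σ u (s ∷ ss) = cong (_ ∨_) (sub-⋁-≐ σ u ss)

direct-⋁-≐ : (u : Term L₀ n) (ss : List Word) →
             direct (⋁ (map (λ s → u ≐ ⌜ s ⌝₀) ss)) ≡ ⋁ (map (λ s → directᵗ u ≐ ⌜ s ⌝ᵢ) ss)
direct-⋁-≐ u []       = refl
direct-⋁-≐ u (s ∷ ss) = cong (_ ∨_) (direct-⋁-≐ u ss)

module _ {Γ : List (Formula Lᵢ n)} where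

  f-involutive : ∀ x → VWDI ∣ Γ ⊢ fᵢ (fᵢ x) ≐ x
  f-involutive x = ∀-elim (axiom VWDI4) x

  ⊑-const-⇔ : ∀ x t → VWDI ∣ Γ ⊢ x ⊑ᵢ ⌜ t ⌝ᵢ ⇔ ⋁ (map (λ s → x ≐ ⌜ s ⌝ᵢ) (inits t))
  ⊑-const-⇔ x t = subst (λ φ → VWDI ∣ Γ ⊢ x ⊑ᵢ ⌜ t ⌝ᵢ ⇔ φ)
    (trans (cong (_[ x ]) (ren-⋁-≐ _ (var zero) (inits t))) (sub-⋁-≐ _ (var zero) (inits t)))
    (∀-elim (axiom (VWDI3 t)) x)

  same-predecessors : ∀ x t →
    VWDI ∣ Γ ⊢ (∀′ var zero ⊏ᵢ renᵗ suc x ⇔ var zero ⊏ᵢ ⌜ t ⌝ᵢ)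
             ⇒ ⋀ (map (λ d → ⌜ d ∷ [] ⌝ᵢ ⊑ᵢ fᵢ x ∧ ⌜ d ∷ [] ⌝ᵢ ⊑ᵢ fᵢ ⌜ t ⌝ᵢ ⇒ x ≐ ⌜ t ⌝ᵢ) D)
  same-predecessors x t = ∀-elim (axiom (VWDI5 t)) x

  f-transpose : ∀ {x y} → VWDI ∣ Γ ⊢ fᵢ x ≐ y → VWDI ∣ Γ ⊢ x ≐ fᵢ y
  f-transpose p = ≐-trans (≐-sym (f-involutive _)) (fᵢ-cong p)

f-transpose-⇔ : {x y : Term Lᵢ n} → VWDI ⊩ fᵢ x ≐ y ⇔ x ≐ fᵢ y
f-transpose-⇔ = ∧-intro (⇒-intro (f-transpose hyp₀))
                        (⇒-intro (≐-sym (f-transpose (≐-sym hyp₀))))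

-- The left side is the direct reading of `⊐₀` with `fᵢ y` in the place of the smaller segment; the
-- involution moves `fᵢ` onto `x`.
⊏-f : (x y : Term Lᵢ n) → VWDI ⊩ fᵢ (fᵢ y) ⊑ᵢ fᵢ x ∧ ¬′ (fᵢ y ≐ x) ⇔ y ⊏ᵢ fᵢ x
⊏-f x y = ∧-cong (⊑-cong (f-involutive y) (≐-refl (fᵢ x))) (⇒-cong f-transpose-⇔ ⇔-refl)

⊏-congʳ : (x : Term Lᵢ n) {y z : Term Lᵢ n} → VWDI ⊩ y ≐ z → VWDI ⊩ x ⊏ᵢ y ⇔ x ⊏ᵢ z
⊏-congʳ x p = ∧-cong (⊑-cong (≐-refl x) p)
  (⇒-cong (∧-intro (⇒-intro (≐-trans hyp₀ p)) (⇒-intro (≐-trans hyp₀ (≐-sym p)))) ⇔-refl)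

-- `VWDI3` lists the initial segments of `reverse t`; transposing `fᵢ` turns each equation
-- `fᵢ x ≐ ⌜ s ⌝ᵢ` into one between `x` and the reversed word.
f-⊑-const-⇔ : (x : Term Lᵢ n) (t : Word) →
              VWDI ⊩ fᵢ x ⊑ᵢ fᵢ ⌜ t ⌝ᵢ ⇔ ⋁ (map (λ s → x ≐ ⌜ s ⌝ᵢ) (tails t))
f-⊑-const-⇔ x t = ⇔-trans (⊑-cong (≐-refl (fᵢ x)) (axiom (VWDI2 t)))
  (⇔-trans (⊑-const-⇔ (fᵢ x) (reverse t)) (∧-intro
    (⋁-elim _ (inits (reverse t)) λ {s} s∈ → ⇒-intro
      (⋁-intro (λ s → x ≐ ⌜ s ⌝ᵢ) (reverse-∈-tails t s∈)
        (≐-trans (f-transpose hyp₀) (axiom (VWDI2 s)))))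
    (⋁-elim _ (tails t) λ {s} s∈ → ⇒-intro
      (⋁-intro (λ s → fᵢ x ≐ ⌜ s ⌝ᵢ) (reverse-∈-inits t s∈)
        (≐-trans (fᵢ-cong hyp₀) (axiom (VWDI2 s)))))))

-- The axioms of `VW₀` derived in `VWDI`

direct-axiom : ∀ {φ} → VW₀ φ → VWDI ⊢ direct φ
direct-axiom (VW₀1 s t s≢t) = axiom (VWDI1 s t s≢t)
direct-axiom (VW₀2 t) = ∀-intro
  (subst (λ φ → VWDI ∣ [] ⊢ var zero ⊑ᵢ ⌜ t ⌝ᵢ ⇔ φ) (sym (direct-⋁-≐ (var zero) (inits t)))
    (⊑-const-⇔ (var zero) t))
direct-axiom (VW₀3 t) = ∀-intro
  (subst (λ φ → VWDI ∣ [] ⊢ fᵢ (var zero) ⊑ᵢ fᵢ ⌜ t ⌝ᵢ ⇔ φ) (sym (direct-⋁-≐ (var zero) (tails t)))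
    (f-⊑-const-⇔ (var zero) t))
direct-axiom (VW₀4 t) = ∀-intro (⇒-intro
  (⋀-map
    (λ d → ⌜ d ∷ [] ⌝ᵢ ⊑ᵢ fᵢ (var zero) ∧ ⌜ d ∷ [] ⌝ᵢ ⊑ᵢ fᵢ ⌜ t ⌝ᵢ ⇒ var zero ≐ ⌜ t ⌝ᵢ)
    (λ d → fᵢ ⌜ d ∷ [] ⌝ᵢ ⊑ᵢ fᵢ (var zero) ∧ fᵢ ⌜ d ∷ [] ⌝ᵢ ⊑ᵢ fᵢ ⌜ t ⌝ᵢ
           ⇒ var zero ≐ ⌜ t ⌝ᵢ)
    -- A one-letter word is its own reversal, so by `VWDI2` its constant is fixed by `fᵢ`.
    (λ d → ⇔-to (⇒-cong (∧-cong (⊑-cong (≐-sym (axiom (VWDI2 (d ∷ [])))) (≐-refl _))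
                               (⊑-cong (≐-sym (axiom (VWDI2 (d ∷ [])))) (≐-refl _)))
                       ⇔-refl))
    D (⇒-elim (same-predecessors (var zero) t) hyp₀)))
direct-axiom (VW₀5 t) = ∀-intro (⇒-intro
  (⋀-map
    (λ d → ⌜ d ∷ [] ⌝ᵢ ⊑ᵢ fᵢ (fᵢ (var zero)) ∧ ⌜ d ∷ [] ⌝ᵢ ⊑ᵢ fᵢ ⌜ reverse t ⌝ᵢ
           ⇒ fᵢ (var zero) ≐ ⌜ reverse t ⌝ᵢ)
    (λ d → ⌜ d ∷ [] ⌝ᵢ ⊑ᵢ var zero ∧ ⌜ d ∷ [] ⌝ᵢ ⊑ᵢ ⌜ t ⌝ᵢ ⇒ var zero ≐ ⌜ t ⌝ᵢ)
    (λ d → ⇔-to (⇒-cong (∧-cong (⊑-cong (≐-refl _) (f-involutive _))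
                               (⊑-cong (≐-refl _) f-reverse))
                       (∧-intro (⇒-intro (≐-trans (f-transpose hyp₀) f-reverse))
                                (⇒-intro (≐-trans (fᵢ-cong hyp₀) (axiom (VWDI2 t)))))))
    D (⇒-elim (same-predecessors (fᵢ (var zero)) (reverse t))
        -- The hypothesis on proper end segments, taken at `fᵢ y`, becomes the hypothesis of `VWDI5`
        -- on proper initial segments. The outer symmetries keep the context-dependent equivalence
        -- first in `⇔-trans`.
        (∀-intro (⇔-sym (⇔-trans
          (⇔-sym (⇔-trans (∀-elim hyp₀ (fᵢ (var zero)))
            (⇔-trans (⊏-f ⌜ t ⌝ᵢ (var zero)) (⊏-congʳ (var zero) (axiom (VWDI2 t))))))
          (⊏-f (var (suc zero)) (var zero))))))))
  where
  f-reverse : VWDI ⊩ fᵢ ⌜ reverse t ⌝ᵢ ≐ ⌜ t ⌝ᵢ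
  f-reverse = ≐-sym (f-transpose (axiom (VWDI2 t)))
direct-axiom VW10 = axiom VW10

theorem8p2 : VW₀ ≤I VWDI
theorem8p2 = record
  { translation     = end⇒f
  ; domain-nonempty = ∃-intro ⌜ [] ⌝ᵢ ⊤-intro
  ; functions       = λ { (const s) → ⇒-intro (∃-intro ⌜ s ⌝ᵢ (∧-intro
      (∧-intro ⊤-intro (≐-refl ⌜ s ⌝ᵢ))
      (∀-intro (⇒-intro (∧-elimʳ hyp₀))))) }
  ; axioms          = λ {φ} ax → ⇔-from (translate-⇔ φ) (direct-axiom ax)
  }
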